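{- Let $n\geq 1$, $q\geq 2$ and $s\geq 1$ be integers. For each $1\leq i\leq n$ let $A_i\subseteq \mathbb{R}$ be a subset with $|A_i|=q$, and consider the box $\mathcal{B}:=\prod_{i=1}^n A_i\subseteq \mathbb{R}^n$. Suppose that $\mathcal{F}\subseteq \mathcal{B}$ is a set such that $|d(\mathcal{F})|\leq s$. Let $d:=\frac{n(q-1)}{s}$, where $d$ is an integer with $d\geq 2$ (so that $J(q,d)$ is defined). Then $$ |\mathcal{F}|\leq 2\,(q\,J(q,d))^n . $$
   Context: For a set $\mathcal{G}\subseteq\mathbb{R}^n$, $d(\mathcal{G})$ denotes the set of non-zero Euclidean distances among points of $\mathcal{G}$: $d(\mathcal{G}):=\{d(\mathbf{p}_1,\mathbf{p}_2): \mathbf{p}_1,\mathbf{p}_2\in\mathcal{G},\ \mathbf{p}_1\neq\mathbf{p}_2\}$, where $d(\mathbf{p}_1,\mathbf{p}_2)$ is the Euclidean distance. (The number $d=\frac{n(q-1)}{s}$ in the claim is unrelated to this notation.) For integers $t,d\geq 2$, define $$ J(t,d):=\frac{1}{t}\left(\min_{0<x<1} \frac{1-x^t}{1-x}\, x^{ -\frac{t-1}{d}}\right) . $$ -}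

module Defs where

open import Algebra.Bundles using (CommutativeRing; Semiring)
open import Algebra.Structures using (IsCommutativeRing)
open import Data.Empty using (⊥-elim)
open import Data.Fin.Base using (Fin) renaming (zero to zeroᶠ; suc to sucᶠ)
open import Data.Nat.Base as ℕ using (ℕ; zero; suc; z≤n; s≤s)
open import Data.Product.Base using (Σ; Σ-syntax; ∃; ∃-syntax; _×_; _,_; proj₁; proj₂)
open import Data.Sum.Base using (inj₁; inj₂)
open import Data.Vec.Functional using (Vector)
import Data.Nat.Properties as ℕ using (<⇒≤)
import Data.Vec.Functional.Relation.Binary.Pointwise.Properties as Pointwise
open import Function.Bundles using (Bijection)
open import Level using (Lift; lift; _⊔_) renaming (suc to lsuc)
open import Relation.Binary.Bundles using (Setoid; DecTotalOrder)
open import Relation.Binary.Core using (Rel)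
open import Relation.Binary.Definitions using (tri<; tri≈; tri>)
import Relation.Binary.Construct.On as On
import Relation.Binary.PropositionalEquality as ≡
import Relation.Binary.Properties.DecTotalOrder as DecTotalOrderProperties
open import Relation.Binary.Structures using (IsDecTotalOrder)
open import Relation.Nullary.Decidable.Core using (yes; no)
open import Relation.Nullary.Negation.Core using (¬_)
open import Relation.Unary using (Pred)

-- A subset of a setoid is given by a predicate, which need not respect _≈_;
-- it stands for the set of all elements equal to one satisfying it. In
-- particular elements are counted up to _≈_.

HasCardinality : ∀ {a ℓ p} (S : Setoid a ℓ) → Pred (Setoid.Carrier S) p → ℕ →
                 Set (a ⊔ ℓ ⊔ p)
HasCardinality S P m =
  Bijection (≡.setoid (Fin m)) (On.setoid {B = ∃ P} S proj₁)

-- The axioms of the real numbers. Classically every order is decidable, and ℝ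
-- is the only model up to isomorphism.

record CompleteOrderedField c ℓ₁ ℓ₂ : Set (lsuc (c ⊔ ℓ₁ ⊔ ℓ₂)) where
  infix  8 -_
  infixl 7 _*_
  infixl 6 _+_
  infix  4 _≈_ _≤_
  field
    Carrier : Set c
    _≈_     : Rel Carrier ℓ₁
    _≤_     : Rel Carrier ℓ₂
    _+_     : Carrier → Carrier → Carrier
    _*_     : Carrier → Carrier → Carrier
    -_      : Carrier → Carrier
    0#      : Carrier
    1#      : Carrier

    isCommutativeRing : IsCommutativeRing _≈_ _+_ _*_ -_ 0# 1#
    0≉1               : ¬ 0# ≈ 1#
    inverse           : ∀ x → ¬ x ≈ 0# → ∃[ y ] x * y ≈ 1#

    isDecTotalOrder   : IsDecTotalOrder _≈_ _≤_
    +-monoˡ-≤         : ∀ z {x y} → x ≤ y → x + z ≤ y + z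
    *-nonNegative     : ∀ {x y} → 0# ≤ x → 0# ≤ y → 0# ≤ x * y

  IsUpperBound : ∀ {p} → Pred Carrier p → Pred Carrier (c ⊔ ℓ₂ ⊔ p)
  IsUpperBound P u = ∀ x → P x → x ≤ u

  IsLowerBound : ∀ {p} → Pred Carrier p → Pred Carrier (c ⊔ ℓ₂ ⊔ p)
  IsLowerBound P l = ∀ x → P x → l ≤ x

  IsSupremum : ∀ {p} → Pred Carrier p → Pred Carrier (c ⊔ ℓ₂ ⊔ p)
  IsSupremum P u = IsUpperBound P u × IsLowerBound (IsUpperBound P) u

  IsInfimum : ∀ {p} → Pred Carrier p → Pred Carrier (c ⊔ ℓ₂ ⊔ p)
  IsInfimum P l = IsLowerBound P l × IsUpperBound (IsLowerBound P) l

  field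
    supremum : (P : Pred Carrier (c ⊔ ℓ₁ ⊔ ℓ₂)) →
               ∃ P → ∃ (IsUpperBound P) → ∃ (IsSupremum P)

module Reals {c ℓ₁ ℓ₂} (R : CompleteOrderedField c ℓ₁ ℓ₂) where

  open CompleteOrderedField R public
    using ( 0≉1; inverse; +-monoˡ-≤; *-nonNegative; supremum
          ; IsUpperBound; IsLowerBound; IsSupremum; IsInfimum)

  commutativeRing : CommutativeRing c ℓ₁
  commutativeRing = record
    { isCommutativeRing = CompleteOrderedField.isCommutativeRing R }

  open CommutativeRing commutativeRing public hiding (_≉_)

  decTotalOrder : DecTotalOrder c ℓ₁ ℓ₂
  decTotalOrder = record
    { isDecTotalOrder = CompleteOrderedField.isDecTotalOrder R }

  open DecTotalOrder decTotalOrder public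
    using (_≤_; _≤?_; _≟_; total; antisym; ≤-respʳ-≈; ≤-respˡ-≈)
    renaming (refl to ≤-refl; trans to ≤-trans; reflexive to ≤-reflexive)
  open DecTotalOrderProperties decTotalOrder public
    using (_<_; <-compare; <⇒≉; ≤∧≉⇒<; <⇒≱; ≰⇒>; ≰⇒≥; ≮⇒≥; <-irrefl)
  open import Algebra.Definitions.RawSemiring (Semiring.rawSemiring semiring) public
    using (_^_; sum) renaming (_×_ to _×ᴿ_)
  open import Algebra.Properties.Ring ring public
    using (-‿distribˡ-*; -‿distribʳ-*; -‿involutive; -0#≈0#; [y-z]x≈yx-zx)
  open import Algebra.Properties.Semiring.Exp semiring public
    using (^-congˡ)

  infix 4 _≉_
  _≉_ : Rel Carrier ℓ₁
  x ≉ y = ¬ x ≈ y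

  fromℕ : ℕ → Carrier
  fromℕ n = n ×ᴿ 1#

  inv : (x : Carrier) → x ≉ 0# → Carrier
  inv x x≉0 = proj₁ (inverse x x≉0)

  vectorSetoid : ℕ → Setoid c ℓ₁
  vectorSetoid n = Pointwise.setoid setoid n

  open import Relation.Binary.Reasoning.Setoid setoid

  <⇒≤ : ∀ {x y} → x < y → x ≤ y
  <⇒≤ = proj₁

  <-≤-trans : ∀ {x y z} → x < y → y ≤ z → x < z
  <-≤-trans x<y y≤z = ≰⇒> (λ z≤x → <⇒≱ x<y (≤-trans y≤z z≤x))

  ≤-<-trans : ∀ {x y z} → x ≤ y → y < z → x < z
  ≤-<-trans x≤y y<z = ≰⇒> (λ z≤x → <⇒≱ y<z (≤-trans z≤x x≤y))

  0<⇒≉0 : ∀ {x} → 0# < x → x ≉ 0#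
  0<⇒≉0 0<x x≈0 = <⇒≉ 0<x (sym x≈0)

  +-monoʳ-≤ : ∀ z {x y} → x ≤ y → z + x ≤ z + y
  +-monoʳ-≤ z {x} {y} x≤y =
    ≤-respˡ-≈ (+-comm x z) (≤-respʳ-≈ (+-comm y z) (+-monoˡ-≤ z x≤y))

  +-mono-≤ : ∀ {w x y z} → w ≤ x → y ≤ z → w + y ≤ x + z
  +-mono-≤ {x = x} {y = y} w≤x y≤z = ≤-trans (+-monoˡ-≤ y w≤x) (+-monoʳ-≤ x y≤z)

  x+[y-x]≈y : ∀ x y → x + (y - x) ≈ y
  x+[y-x]≈y x y = begin
    x + (y - x)     ≈⟨ +-comm x (y - x) ⟩
    (y - x) + x     ≈⟨ +-assoc y (- x) x ⟩
    y + (- x + x)   ≈⟨ +-congˡ (-‿inverseˡ x) ⟩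
    y + 0#          ≈⟨ +-identityʳ y ⟩
    y               ∎

  [x+y]-x≈y : ∀ x y → (x + y) - x ≈ y
  [x+y]-x≈y x y = begin
    (x + y) - x     ≈⟨ +-congʳ (+-comm x y) ⟩
    (y + x) - x     ≈⟨ +-assoc y x (- x) ⟩
    y + (x - x)     ≈⟨ +-congˡ (-‿inverseʳ x) ⟩
    y + 0#          ≈⟨ +-identityʳ y ⟩
    y               ∎

  +-cancelˡ-≤ : ∀ x {y z} → x + y ≤ x + z → y ≤ z
  +-cancelˡ-≤ x {y} {z} h =
    ≤-respˡ-≈ ([x+y]-x≈y x y) (≤-respʳ-≈ ([x+y]-x≈y x z) (+-monoˡ-≤ (- x) h))

  +-monoʳ-< : ∀ z {x y} → x < y → z + x < z + y
  +-monoʳ-< z x<y = ≰⇒> (λ h → <⇒≱ x<y (+-cancelˡ-≤ z h))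

  x<x+ε : ∀ {x ε} → 0# < ε → x < x + ε
  x<x+ε {x} 0<ε = ≤-<-trans (≤-reflexive (sym (+-identityʳ x))) (+-monoʳ-< x 0<ε)

  x≤y⇒0≤y-x : ∀ {x y} → x ≤ y → 0# ≤ y - x
  x≤y⇒0≤y-x {x} x≤y = ≤-respˡ-≈ (-‿inverseʳ x) (+-monoˡ-≤ (- x) x≤y)

  0≤y-x⇒x≤y : ∀ {x y} → 0# ≤ y - x → x ≤ y
  0≤y-x⇒x≤y {x} {y} h =
    ≤-respˡ-≈ (+-identityʳ x) (≤-respʳ-≈ (x+[y-x]≈y x y) (+-monoʳ-≤ x h))

  x<y⇒0<y-x : ∀ {x y} → x < y → 0# < y - x
  x<y⇒0<y-x {x} {y} x<y = ≰⇒> (λ h → <⇒≱ x<y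
    (≤-respˡ-≈ (x+[y-x]≈y x y) (≤-respʳ-≈ (+-identityʳ x) (+-monoʳ-≤ x h))))

  x≤0⇒0≤-x : ∀ {x} → x ≤ 0# → 0# ≤ - x
  x≤0⇒0≤-x {x} x≤0 = ≤-respʳ-≈ (+-identityˡ (- x)) (x≤y⇒0≤y-x x≤0)

  0≤-x⇒x≤0 : ∀ {x} → 0# ≤ - x → x ≤ 0#
  0≤-x⇒x≤0 {x} h = 0≤y-x⇒x≤y (≤-respʳ-≈ (sym (+-identityˡ (- x))) h)

  0<1 : 0# < 1#
  0<1 with total 0# 1#
  ... | inj₁ 0≤1 = 0≤1 , 0≉1
  ... | inj₂ 1≤0 = ≤-respʳ-≈ -1*-1≈1 (*-nonNegative 0≤-1 0≤-1) , 0≉1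
    where
    0≤-1 = x≤0⇒0≤-x 1≤0
    -1*-1≈1 : - 1# * - 1# ≈ 1#
    -1*-1≈1 = begin
      - 1# * - 1#     ≈⟨ -‿distribˡ-* 1# (- 1#) ⟨
      - (1# * - 1#)   ≈⟨ -‿cong (*-identityˡ (- 1#)) ⟩
      - - 1#          ≈⟨ -‿involutive 1# ⟩
      1#              ∎

  *-monoˡ-≤ : ∀ {x y z} → 0# ≤ z → x ≤ y → x * z ≤ y * z
  *-monoˡ-≤ {x} {y} {z} 0≤z x≤y =
    0≤y-x⇒x≤y (≤-respʳ-≈ ([y-z]x≈yx-zx z y x) (*-nonNegative (x≤y⇒0≤y-x x≤y) 0≤z))

  *-monoʳ-≤ : ∀ {x y z} → 0# ≤ z → x ≤ y → z * x ≤ z * y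
  *-monoʳ-≤ {x} {y} {z} 0≤z x≤y =
    ≤-respˡ-≈ (*-comm x z) (≤-respʳ-≈ (*-comm y z) (*-monoˡ-≤ 0≤z x≤y))

  *-mono-≤ : ∀ {w x y z} → 0# ≤ x → 0# ≤ y → w ≤ x → y ≤ z → w * y ≤ x * z
  *-mono-≤ 0≤x 0≤y w≤x y≤z = ≤-trans (*-monoˡ-≤ 0≤y w≤x) (*-monoʳ-≤ 0≤x y≤z)

  *-positive : ∀ {x y} → 0# < x → 0# < y → 0# < x * y
  *-positive {x} {y} 0<x 0<y =
    *-nonNegative (<⇒≤ 0<x) (<⇒≤ 0<y) , λ 0≈xy → <⇒≉ 0<y (sym (begin
      y               ≈⟨ *-identityˡ y ⟨
      1# * y          ≈⟨ *-congʳ (proj₂ (inverse x x≉0)) ⟨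
      (x * x⁻¹) * y   ≈⟨ *-congʳ (*-comm x x⁻¹) ⟩
      (x⁻¹ * x) * y   ≈⟨ *-assoc x⁻¹ x y ⟩
      x⁻¹ * (x * y)   ≈⟨ *-congˡ 0≈xy ⟨
      x⁻¹ * 0#        ≈⟨ zeroʳ x⁻¹ ⟩
      0#              ∎))
    where
    x≉0 = 0<⇒≉0 0<x
    x⁻¹ = inv x x≉0

  inv-positive : ∀ {x} (x≉0 : x ≉ 0#) → 0# < x → 0# < inv x x≉0
  inv-positive {x} x≉0 0<x = ≰⇒> λ x⁻¹≤0 → <⇒≱ 0<1 (0≤-x⇒x≤0
    (≤-respʳ-≈ (begin
      x * - inv x x≉0     ≈⟨ -‿distribʳ-* x (inv x x≉0) ⟨
      - (x * inv x x≉0)   ≈⟨ -‿cong (proj₂ (inverse x x≉0)) ⟩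
      - 1#                ∎)
    (*-nonNegative (<⇒≤ 0<x) (x≤0⇒0≤-x x⁻¹≤0))))

  ^-nonNegative : ∀ {x} k → 0# ≤ x → 0# ≤ x ^ k
  ^-nonNegative zero    0≤x = <⇒≤ 0<1
  ^-nonNegative (suc k) 0≤x = *-nonNegative 0≤x (^-nonNegative k 0≤x)

  ^-positive : ∀ {x} k → 0# < x → 0# < x ^ k
  ^-positive zero    0<x = 0<1
  ^-positive (suc k) 0<x = *-positive 0<x (^-positive k 0<x)

  ^-mono-≤ : ∀ {x y} k → 0# ≤ x → x ≤ y → x ^ k ≤ y ^ k
  ^-mono-≤ zero    0≤x x≤y = ≤-refl
  ^-mono-≤ (suc k) 0≤x x≤y =
    *-mono-≤ (≤-trans 0≤x x≤y) (^-nonNegative k 0≤x) x≤y (^-mono-≤ k 0≤x x≤y)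

  1^k≈1 : ∀ k → 1# ^ k ≈ 1#
  1^k≈1 zero    = refl
  1^k≈1 (suc k) = trans (*-identityˡ (1# ^ k)) (1^k≈1 k)

  abstract
    ^-increment : ∀ k {r} → 0# ≤ r → ∃[ C ] (0# ≤ C × (∀ {y ε} →
      0# ≤ y → y ≤ r → 0# ≤ ε → ε ≤ 1# → (y + ε) ^ k ≤ y ^ k + ε * C))
    ^-increment zero 0≤r = 0# , ≤-refl , λ {y} {ε} _ _ _ _ →
      ≤-reflexive (sym (trans (+-congˡ (zeroʳ ε)) (+-identityʳ 1#)))
    ^-increment (suc k) {r} 0≤r with ^-increment k 0≤r
    ... | C , 0≤C , bound = C′ , 0≤C′ , bound′
      where
      C′ : Carrier
      C′ = (r * C + C) + r ^ k
      0≤+ : ∀ {x y} → 0# ≤ x → 0# ≤ y → 0# ≤ x + y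
      0≤+ 0≤x 0≤y = ≤-respˡ-≈ (+-identityʳ 0#) (+-mono-≤ 0≤x 0≤y)
      0≤C′ : 0# ≤ C′
      0≤C′ = 0≤+ (0≤+ (*-nonNegative 0≤r 0≤C) 0≤C) (^-nonNegative k 0≤r)
      bound′ : ∀ {y ε} → 0# ≤ y → y ≤ r → 0# ≤ ε → ε ≤ 1# →
               (y + ε) ^ suc k ≤ y ^ suc k + ε * C′
      bound′ {y} {ε} 0≤y y≤r 0≤ε ε≤1 =
        ≤-trans (*-monoʳ-≤ (0≤+ 0≤y 0≤ε) (bound 0≤y y≤r 0≤ε ε≤1))
        (≤-respˡ-≈ (sym expand) (+-monoʳ-≤ (y * y ^ k) (*-monoʳ-≤ 0≤ε
          (+-mono-≤ (+-mono-≤ (*-monoˡ-≤ 0≤C y≤r)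
                      (≤-respʳ-≈ (*-identityˡ C) (*-monoˡ-≤ 0≤C ε≤1)))
                    (^-mono-≤ k 0≤y y≤r)))))
        where
        Y : Carrier
        Y = y ^ k
        expand : (y + ε) * (Y + ε * C) ≈ y * Y + ε * ((y * C + ε * C) + Y)
        expand = begin
          (y + ε) * (Y + ε * C)
            ≈⟨ distribʳ (Y + ε * C) y ε ⟩
          y * (Y + ε * C) + ε * (Y + ε * C)
            ≈⟨ +-congʳ (distribˡ y Y (ε * C)) ⟩
          (y * Y + y * (ε * C)) + ε * (Y + ε * C)
            ≈⟨ +-assoc (y * Y) (y * (ε * C)) (ε * (Y + ε * C)) ⟩
          y * Y + (y * (ε * C) + ε * (Y + ε * C))
            ≈⟨ +-congˡ (+-congʳ (begin
                 y * (ε * C)   ≈⟨ *-assoc y ε C ⟨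
                 (y * ε) * C   ≈⟨ *-congʳ (*-comm y ε) ⟩
                 (ε * y) * C   ≈⟨ *-assoc ε y C ⟩
                 ε * (y * C)   ∎)) ⟩
          y * Y + (ε * (y * C) + ε * (Y + ε * C))
            ≈⟨ +-congˡ (distribˡ ε (y * C) (Y + ε * C)) ⟨
          y * Y + ε * (y * C + (Y + ε * C))
            ≈⟨ +-congˡ (*-congˡ (+-congˡ (+-comm Y (ε * C)))) ⟩
          y * Y + ε * (y * C + (ε * C + Y))
            ≈⟨ +-congˡ (*-congˡ (+-assoc (y * C) (ε * C) Y)) ⟨
          y * Y + ε * ((y * C + ε * C) + Y) ∎

    smallStep : ∀ {C δ} → 0# ≤ C → 0# < δ →
                ∃[ ε ] (0# < ε × ε ≤ 1# × ε * C < δ)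
    smallStep {C} {δ} 0≤C 0<δ = ε , 0<ε , ε≤1 , εC<δ
      where
      E : Carrier
      E = 1# + δ
      0<E : 0# < E
      0<E = <-≤-trans 0<1
        (≤-respˡ-≈ (+-identityʳ 1#) (+-monoʳ-≤ 1# (<⇒≤ 0<δ)))
      D : Carrier
      D = C + E
      E≤D : E ≤ D
      E≤D = ≤-respˡ-≈ (+-identityˡ E) (+-monoˡ-≤ E 0≤C)
      0<D : 0# < D
      0<D = <-≤-trans 0<E E≤D
      D≉0 : D ≉ 0#
      D≉0 = 0<⇒≉0 0<D
      D⁻¹ : Carrier
      D⁻¹ = inv D D≉0
      0<D⁻¹ : 0# < D⁻¹
      0<D⁻¹ = inv-positive D≉0 0<D
      ε : Carrier
      ε = δ * D⁻¹
      0<ε : 0# < ε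
      0<ε = *-positive 0<δ 0<D⁻¹
      δ≤D : δ ≤ D
      δ≤D = ≤-trans (≤-respˡ-≈ (+-identityˡ δ) (+-monoˡ-≤ δ (<⇒≤ 0<1))) E≤D
      ε≤1 : ε ≤ 1#
      ε≤1 = ≤-respʳ-≈ (proj₂ (inverse D D≉0)) (*-monoˡ-≤ (<⇒≤ 0<D⁻¹) δ≤D)
      εD≈δ : ε * D ≈ δ
      εD≈δ = begin
        (δ * D⁻¹) * D   ≈⟨ *-assoc δ D⁻¹ D ⟩
        δ * (D⁻¹ * D)   ≈⟨ *-congˡ (*-comm D⁻¹ D) ⟩
        δ * (D * D⁻¹)   ≈⟨ *-congˡ (proj₂ (inverse D D≉0)) ⟩
        δ * 1#          ≈⟨ *-identityʳ δ ⟩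
        δ               ∎
      εC<δ : ε * C < δ
      εC<δ = ≤-<-trans (≤-reflexive (sym (+-identityʳ (ε * C))))
        (<-≤-trans (+-monoʳ-< (ε * C) (*-positive 0<ε 0<E))
          (≤-reflexive (trans (sym (distribˡ ε C E)) εD≈δ)))

  SubRoot : ℕ → Carrier → Pred Carrier (c ⊔ ℓ₁ ⊔ ℓ₂)
  SubRoot k x y = Lift (c ⊔ ℓ₁ ⊔ ℓ₂) (0# ≤ y × y ^ k ≤ x)

  0∈SubRoot : ∀ m {x} → 0# ≤ x → SubRoot (suc m) x 0#
  0∈SubRoot m 0≤x = lift (≤-refl , ≤-respˡ-≈ (sym (zeroˡ (0# ^ m))) 0≤x)

  SubRoot-bounded : ∀ m {x} → 0# ≤ x → IsUpperBound (SubRoot (suc m) x) (1# + x)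
  SubRoot-bounded m {x} 0≤x y (lift (0≤y , y^k≤x)) with y ≤? (1# + x)
  ... | yes p = p
  ... | no ¬p = ⊥-elim (¬p (≤-trans y≤x
                  (≤-respˡ-≈ (+-identityˡ x) (+-monoˡ-≤ x (<⇒≤ 0<1)))))
    where
    1≤y : 1# ≤ y
    1≤y = ≤-trans (≤-respˡ-≈ (+-identityʳ 1#) (+-monoʳ-≤ 1# 0≤x)) (≰⇒≥ ¬p)
    y≤x : y ≤ x
    y≤x = ≤-trans (≤-respˡ-≈ (trans (*-congˡ (1^k≈1 m)) (*-identityʳ y))
            (*-monoʳ-≤ 0≤y (^-mono-≤ m (<⇒≤ 0<1) 1≤y))) y^k≤x

  supremum-SubRoot : ∀ k {x r} → 0# ≤ r → IsSupremum (SubRoot k x) r → r ^ k ≈ x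
  supremum-SubRoot k {x} {r} 0≤r (upper , least)
    with ^-increment k 0≤r | <-compare (r ^ k) x
  ... | _ | tri≈ _ r^k≈x _ = r^k≈x
  ... | C , 0≤C , increment | tri< r^k<x _ _ with smallStep 0≤C (x<y⇒0<y-x r^k<x)
  ...   | ε , 0<ε , ε≤1 , εC<δ = ⊥-elim (<⇒≱ (x<x+ε 0<ε) (upper (r + ε) (lift
            ( ≤-trans 0≤r (<⇒≤ (x<x+ε 0<ε))
            , ≤-trans (increment 0≤r ≤-refl (<⇒≤ 0<ε) ε≤1)
                (≤-respʳ-≈ (x+[y-x]≈y (r ^ k) x)
                  (+-monoʳ-≤ (r ^ k) (<⇒≤ εC<δ)))))))
  supremum-SubRoot k {x} {r} 0≤r (upper , least)
      | C , 0≤C , increment | tri> _ _ x<r^k with smallStep 0≤C (x<y⇒0<y-x x<r^k)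
  ...   | ε , 0<ε , ε≤1 , εC<δ = ⊥-elim (<⇒≱ (x<x+ε 0<ε)
            (≤-respˡ-≈ (+-comm ε r) (≤-respʳ-≈ (x+[y-x]≈y ε r)
              (+-monoʳ-≤ ε (least (r - ε) smaller)))))
    where
    smaller : IsUpperBound (SubRoot k x) (r - ε)
    smaller y y∈S@(lift (0≤y , y^k≤x)) with y ≤? (r - ε)
    ... | yes p = p
    ... | no ¬p = ⊥-elim (<⇒≱ x+εC<r^k (≤-trans (^-mono-≤ k 0≤r r≤y+ε)
                    (≤-trans (increment 0≤y (upper y y∈S) (<⇒≤ 0<ε) ε≤1)
                      (+-monoˡ-≤ (ε * C) y^k≤x))))
      where
      r≤y+ε : r ≤ y + ε
      r≤y+ε = ≤-respˡ-≈ (x+[y-x]≈y ε r)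
        (≤-respʳ-≈ (+-comm ε y) (+-monoʳ-≤ ε (≰⇒≥ ¬p)))
      x+εC<r^k : x + ε * C < r ^ k
      x+εC<r^k = <-≤-trans (+-monoʳ-< x εC<δ)
        (≤-reflexive (x+[y-x]≈y x (r ^ k)))

  abstract
    rootExists : ∀ k .{{_ : ℕ.NonZero k}} {x} → 0# ≤ x →
                 ∃[ y ] (0# ≤ y × y ^ k ≈ x)
    rootExists (suc m) {x} 0≤x =
      let r , isSup = supremum (SubRoot (suc m) x) (0# , 0∈SubRoot m 0≤x)
                        (1# + x , SubRoot-bounded m 0≤x)
          0≤r = proj₁ isSup 0# (0∈SubRoot m 0≤x)
      in r , 0≤r , supremum-SubRoot (suc m) 0≤r isSup

  root : ∀ k .{{_ : ℕ.NonZero k}} x → 0# ≤ x → Carrier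
  root k x 0≤x = proj₁ (rootExists k 0≤x)

  root-positive : ∀ k .{{_ : ℕ.NonZero k}} {x} (0<x : 0# < x) →
                  0# < root k x (<⇒≤ 0<x)
  root-positive k@(suc m) {x} 0<x = 0≤y , λ 0≈y → <⇒≉ 0<x (begin
      0#                  ≈⟨ zeroˡ (0# ^ m) ⟨
      0# ^ k              ≈⟨ ^-congˡ k 0≈y ⟩
      root k x 0≤x ^ k    ≈⟨ proj₂ (proj₂ (rootExists k 0≤x)) ⟩
      x                   ∎)
    where
    0≤x = <⇒≤ 0<x
    0≤y = proj₁ (proj₂ (rootExists k 0≤x))

  -- x ^-[ a / b ] is x raised to the rational power -a/b.
  infixl 9 _^-[_/_]⟨_⟩
  _^-[_/_]⟨_⟩ : ∀ x (a b : ℕ) .{{_ : ℕ.NonZero b}} → 0# < x → Carrier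
  x ^-[ a / b ]⟨ 0<x ⟩ = inv (root b x (<⇒≤ 0<x) ^ a)
    (0<⇒≉0 (^-positive a (root-positive b 0<x)))

  infimum : (P : Pred Carrier (c ⊔ ℓ₁ ⊔ ℓ₂)) →
            ∃ P → ∃ (IsLowerBound P) → ∃ (IsInfimum P)
  infimum P (x , x∈P) bounded =
    let s , upper , least =
          supremum (IsLowerBound P) bounded (x , λ l l≤P → l≤P x x∈P)
    in s , (λ y y∈P → least y (λ l l≤P → l≤P y y∈P)) , upper

  sum-nonNegative : ∀ {n} (v : Vector Carrier n) → (∀ i → 0# ≤ v i) → 0# ≤ sum v
  sum-nonNegative {zero}  v 0≤v = ≤-refl
  sum-nonNegative {suc n} v 0≤v = ≤-respˡ-≈ (+-identityʳ 0#)
    (+-mono-≤ (0≤v zeroᶠ) (sum-nonNegative (λ i → v (sucᶠ i)) (λ i → 0≤v (sucᶠ i))))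

  square-nonNegative : ∀ x → 0# ≤ x ^ 2
  square-nonNegative x with total 0# x
  ... | inj₁ 0≤x = ^-nonNegative 2 0≤x
  ... | inj₂ x≤0 = ≤-respʳ-≈ (begin
      - x * - x       ≈⟨ -‿distribˡ-* x (- x) ⟨
      - (x * - x)     ≈⟨ -‿cong (-‿distribʳ-* x x) ⟨
      - - (x * x)     ≈⟨ -‿involutive (x * x) ⟩
      x * x           ≈⟨ *-congˡ (*-identityʳ x) ⟨
      x ^ 2           ∎)
    (*-nonNegative (x≤0⇒0≤-x x≤0) (x≤0⇒0≤-x x≤0))

  squaredDistance : ∀ {n} → Vector Carrier n → Vector Carrier n → Carrier
  squaredDistance p₁ p₂ = sum (λ i → (p₁ i - p₂ i) ^ 2)

  distance : ∀ {n} → Vector Carrier n → Vector Carrier n → Carrier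
  distance p₁ p₂ = root 2 (squaredDistance p₁ p₂)
    (sum-nonNegative _ (λ i → square-nonNegative (p₁ i - p₂ i)))

  distances : ∀ {n f} → Pred (Vector Carrier n) f → Pred Carrier (c ⊔ ℓ₁ ⊔ f)
  distances {n} F r = ∃[ p₁ ] ∃[ p₂ ]
    (F p₁ × F p₂ × ¬ Setoid._≈_ (vectorSetoid n) p₁ p₂ × r ≈ distance p₁ p₂)

  box : ∀ {n a} → (Fin n → Pred Carrier a) → Pred (Vector Carrier n) a
  box A p = ∀ i → A i (p i)

  1-x≉0 : ∀ {x} → x < 1# → 1# - x ≉ 0#
  1-x≉0 x<1 = 0<⇒≉0 (x<y⇒0<y-x x<1)

  objective : (t d : ℕ) → 2 ℕ.≤ d → ∀ x → 0# < x → x < 1# → Carrier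
  objective t d@(suc _) _ x 0<x x<1 =
    ((1# - x ^ t) * inv (1# - x) (1-x≉0 x<1)) * x ^-[ t ℕ.∸ 1 / d ]⟨ 0<x ⟩

  ObjectiveValue : (t d : ℕ) → 2 ℕ.≤ d → Pred Carrier (c ⊔ ℓ₁ ⊔ ℓ₂)
  ObjectiveValue t d 2≤d v =
    ∃[ x ] Σ[ 0<x ∈ 0# < x ] Σ[ x<1 ∈ x < 1# ] v ≈ objective t d 2≤d x 0<x x<1

  fromℕ-positive : ∀ {n} → 1 ℕ.≤ n → 0# < fromℕ n
  fromℕ-positive {suc n} _ = <-≤-trans 0<1
    (≤-respˡ-≈ (+-identityʳ 1#) (+-monoʳ-≤ 1# (fromℕ-nonNegative n)))
    where
    fromℕ-nonNegative : ∀ n → 0# ≤ fromℕ n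
    fromℕ-nonNegative zero    = ≤-refl
    fromℕ-nonNegative (suc n) = ≤-respˡ-≈ (+-identityʳ 0#)
      (+-mono-≤ (<⇒≤ 0<1) (fromℕ-nonNegative n))

  objectiveValue-inhabited : ∀ t d (2≤d : 2 ℕ.≤ d) → ∃ (ObjectiveValue t d 2≤d)
  objectiveValue-inhabited t d 2≤d = _ , h , 0<h , h<1 , refl
    where
    0<2 = fromℕ-positive {2} (s≤s z≤n)
    2≉0 = 0<⇒≉0 0<2
    h   = inv (fromℕ 2) 2≉0
    0<h = inv-positive 2≉0 0<2
    h+h≈1 : h + h ≈ 1#
    h+h≈1 = begin
      h + h                 ≈⟨ +-cong (*-identityˡ h) (*-identityˡ h) ⟨
      1# * h + 1# * h       ≈⟨ distribʳ h 1# 1# ⟨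
      (1# + 1#) * h         ≈⟨ *-congʳ (+-congˡ (+-identityʳ 1#)) ⟨
      fromℕ 2 * h           ≈⟨ proj₂ (inverse (fromℕ 2) 2≉0) ⟩
      1#                    ∎
    h<1 : h < 1#
    h<1 = ≤-<-trans (≤-reflexive (sym (+-identityʳ h)))
      (<-≤-trans (+-monoʳ-< h 0<h) (≤-reflexive h+h≈1))

  objectiveValue-nonNegative : ∀ t d (2≤d : 2 ℕ.≤ d) →
                               IsLowerBound (ObjectiveValue t d 2≤d) 0#
  objectiveValue-nonNegative t d@(suc _) 2≤d v (x , 0<x , x<1 , v≈) =
    ≤-respʳ-≈ (sym v≈) (*-nonNegative
      (*-nonNegative
        (x≤y⇒0≤y-x (≤-respʳ-≈ (1^k≈1 t) (^-mono-≤ t (<⇒≤ 0<x) (<⇒≤ x<1))))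
        (<⇒≤ (inv-positive (1-x≉0 x<1) (x<y⇒0<y-x x<1))))
      (<⇒≤ (inv-positive _ (^-positive (t ℕ.∸ 1) (root-positive d 0<x)))))

  -- The minimum defining J is taken to be an infimum: for d = 2 the function
  -- exceeds t on 0 < x < 1 and tends to t as x → 1, so no minimum is attained.
  J : (t d : ℕ) → 2 ℕ.≤ t → 2 ℕ.≤ d → Carrier
  J t d 2≤t 2≤d =
    inv (fromℕ t) (0<⇒≉0 (fromℕ-positive (ℕ.<⇒≤ 2≤t))) *
    proj₁ (infimum (ObjectiveValue t d 2≤d)
      (objectiveValue-inhabited t d 2≤d) (0# , objectiveValue-nonNegative t d 2≤d))

{-# OPTIONS --safe #-}

-- Let D₁, …, D_k be the distances of F. The matrix h(x, y) = ∏ₗ (|x − y|² − Dₗ²)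
-- indexed by F is a nonzero multiple of the identity, and h has degree 2k ≤ 2s. If a
-- vector w on F is orthogonal to all polynomials of degree at most s, the quadratic
-- form of h vanishes at w, since every monomial of h has degree at most s in x or
-- in y; hence Σ w² = 0 and w = 0. On the box a polynomial of degree at most s is a
-- combination of monomials whose exponents are moreover below q, so |F| is at most
-- the number N of these. For 0 < x < 1,
--   N xˢ ≤ (1 + x + ⋯ + x^(q−1))ⁿ,
-- and since s = n(q−1)/d, dividing by xˢ and taking n-th roots gives the function
-- minimised in J(q,d). Positivity of Σ w² replaces a rank argument and saves the
-- factor 2.

module Submission where

open import Defs
open import Algebra.Bundles using (CommutativeRing; Semiring)
open import Data.Fin.Base using (Fin; punchIn)
  renaming (zero to zeroᶠ; suc to sucᶠ)
open import Data.Fin.Properties using (any?; punchInᵢ≢i)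
open import Data.List.Base as List using (List; []; _∷_; length)
open import Data.List.Membership.Propositional using (_∈_)
open import Data.List.Membership.Propositional.Properties
  using (∈-cartesianProductWith⁺; ∈-downFrom⁺; ∈-filter⁺)
open import Data.List.Relation.Unary.Any using (here; index)
open import Data.List.Relation.Unary.Any.Properties using (lookup-index)
open import Data.Nat.Base as ℕ using (ℕ; zero; suc; s≤s; z≤n)
import Data.Nat.Induction as ℕ
import Data.Nat.Properties as ℕ
open import Data.Product.Base using (∃-syntax; _×_; _,_; proj₁; proj₂)
open import Data.Sum.Base using (_⊎_; inj₁; inj₂)
open import Data.Vec.Base as Vec using (Vec; []; _∷_)
open import Data.Vec.Functional using (Vector; insertAt; removeAt; tail)
open import Data.Vec.Functional.Properties using (insertAt-lookup; insertAt-punchIn)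
open import Data.Vec.Relation.Unary.All as VecAll using ([]; _∷_)
open import Function.Base using (_∘_)
open import Function.Bundles using (Bijection)
open import Level using (_⊔_)
open import Relation.Binary.PropositionalEquality.Core as ≡ using (_≡_)
open import Relation.Nullary.Decidable.Core using (yes; no; ¬?; decidable-stable)
open import Relation.Nullary.Negation.Core using (¬_)
open import Relation.Unary using (Pred; Decidable; _⊆_)

module PolynomialFunctions {c ℓ} (R : CommutativeRing c ℓ) where
  open CommutativeRing R
  open import Algebra.Definitions.RawSemiring (Semiring.rawSemiring semiring)
    using (_^_; sum; product)
  open import Algebra.Properties.AbelianGroup +-abelianGroup using (//-rightDividesˡ)
  open import Algebra.Properties.CommutativeSemigroup *-commutativeSemigroup
    using (x∙yz≈y∙xz; xy∙z≈xz∙y)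
  open import Algebra.Properties.Ring ring using (-1*x≈-x; -‿distribʳ-*)
  open import Algebra.Properties.Semiring.Exp semiring using (^-homo-*)
  open import Algebra.Properties.Semiring.Sum semiring
    using (sum-cong-≋; ∑-distrib-+; *-distribˡ-sum; sum-replicate-zero)
  open import Algebra.Solver.Ring.NaturalCoefficients.Default commutativeSemiring
    using (solve; _:=_; _:+_; _:*_)
  open import Relation.Binary.Reasoning.Setoid setoid

  -- Subspaces of functions and annihilators of a vector.

  record IsSubspace {y p} {Y : Set y} (P : Pred (Y → Carrier) p) :
                    Set (c ⊔ ℓ ⊔ y ⊔ p) where
    field
      respects : ∀ {u v} → (∀ z → u z ≈ v z) → P u → P v
      zero∈    : P (λ _ → 0#)
      +-closed : ∀ {u v} → P u → P v → P (λ z → u z + v z)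
      *-closed : ∀ a {u} → P u → P (λ z → a * u z)

  infix 8 _∙_
  _∙_ : ∀ {m} → Vector Carrier m → Vector Carrier m → Carrier
  w ∙ u = sum (λ i → w i * u i)

  ∙-congˡ : ∀ {m} (w : Vector Carrier m) {u v} → (∀ i → u i ≈ v i) → w ∙ u ≈ w ∙ v
  ∙-congˡ w u≈v = sum-cong-≋ (λ i → *-congˡ (u≈v i))

  ∙-zeroʳ : ∀ {m} (w : Vector Carrier m) {u} → (∀ i → u i ≈ 0#) → w ∙ u ≈ 0#
  ∙-zeroʳ {m} w u≈0 = trans (sum-cong-≋ (λ i → trans (*-congˡ (u≈0 i)) (zeroʳ (w i))))
                           (sum-replicate-zero m)

  ∙-+ : ∀ {m} (w u v : Vector Carrier m) → w ∙ (λ i → u i + v i) ≈ w ∙ u + w ∙ v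
  ∙-+ w u v = trans (sum-cong-≋ (λ i → distribˡ (w i) (u i) (v i)))
                    (∑-distrib-+ (λ i → w i * u i) (λ i → w i * v i))

  ∙-* : ∀ {m} (w : Vector Carrier m) a u → w ∙ (λ i → a * u i) ≈ a * w ∙ u
  ∙-* w a u = trans (sum-cong-≋ (λ i → x∙yz≈y∙xz (w i) a (u i)))
                    (sym (*-distribˡ-sum a (λ i → w i * u i)))

  annihilated-isSubspace : ∀ {m} (w : Vector Carrier m) → IsSubspace (λ u → w ∙ u ≈ 0#)
  annihilated-isSubspace w = record
    { respects = λ u≈v wu≈0 → trans (sym (∙-congˡ w u≈v)) wu≈0
    ; zero∈    = ∙-zeroʳ w (λ _ → refl)
    ; +-closed = λ {u} {v} wu≈0 wv≈0 →
        trans (∙-+ w u v) (trans (+-cong wu≈0 wv≈0) (+-identityˡ 0#))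
    ; *-closed = λ a {u} wu≈0 → trans (∙-* w a u) (trans (*-congˡ wu≈0) (zeroʳ a))
    }

  -- The quadratic form of a matrix `h` at a fixed `w` is linear in `h`. The inner sum is linear in
  -- each row, so every closure property is pulled back from the annihilator of `w` along the vector
  -- of row sums.
  biannihilated-isSubspace : ∀ {m} (w : Vector Carrier m) →
    IsSubspace {Y = Fin m × Fin m} (λ h → w ∙ (λ i → w ∙ (λ j → h (i , j))) ≈ 0#)
  biannihilated-isSubspace w = record
    { respects = λ u≈v → P.respects (λ i → ∙-congˡ w (λ j → u≈v (i , j)))
    ; zero∈    = P.respects (λ i → sym (∙-zeroʳ w (λ _ → refl))) P.zero∈
    ; +-closed = λ Pu Pv → P.respects (λ i → sym (∙-+ w _ _)) (P.+-closed Pu Pv)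
    ; *-closed = λ a Pu → P.respects (λ i → sym (∙-* w a _)) (P.*-closed a Pu)
    }
    where module P = IsSubspace (annihilated-isSubspace w)

  -- Monomials and polynomial functions of bounded degree.

  monomial : ∀ {n} → Vector Carrier n → Vec ℕ n → Carrier
  monomial x []      = 1#
  monomial x (k ∷ e) = x zeroᶠ ^ k * monomial (tail x) e

  monomial-0 : ∀ {n} (x : Vector Carrier n) → monomial x (Vec.replicate n 0) ≈ 1#
  monomial-0 {zero}  x = refl
  monomial-0 {suc n} x = trans (*-identityˡ _) (monomial-0 (tail x))

  monomial-updateAt : ∀ {n} (x : Vector Carrier n) e i →
                      monomial x (Vec.updateAt e i suc) ≈ x i * monomial x e
  monomial-updateAt x (k ∷ e) zeroᶠ    = *-assoc (x zeroᶠ) _ _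
  monomial-updateAt x (k ∷ e) (sucᶠ i) =
    trans (*-congˡ (monomial-updateAt (tail x) e i))
          (x∙yz≈y∙xz (x zeroᶠ ^ k) (x (sucᶠ i)) _)

  sum-0 : ∀ n → Vec.sum (Vec.replicate n 0) ≡ 0
  sum-0 zero    = ≡.refl
  sum-0 (suc n) = sum-0 n

  sum-updateAt : ∀ {n} (e : Vec ℕ n) i →
                 Vec.sum (Vec.updateAt e i suc) ≡ suc (Vec.sum e)
  sum-updateAt (k ∷ e) zeroᶠ    = ≡.refl
  sum-updateAt (k ∷ e) (sucᶠ i) =
    ≡.trans (≡.cong (k ℕ.+_) (sum-updateAt e i)) (ℕ.+-suc k (Vec.sum e))

  -- The index bounds the degree in the functions z v from above.
  data Polynomial {v y} {V : Set v} {Y : Set y} (z : V → Y → Carrier) :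
                  ℕ → (Y → Carrier) → Set (c ⊔ v ⊔ y) where
    const  : ∀ a → Polynomial z 0 (λ _ → a)
    var    : ∀ v → Polynomial z 1 (z v)
    weaken : ∀ {s t g} → s ℕ.≤ t → Polynomial z s g → Polynomial z t g
    _⊕_    : ∀ {t g h} → Polynomial z t g → Polynomial z t h →
             Polynomial z t (λ y → g y + h y)
    _⊗_    : ∀ {s t g h} → Polynomial z s g → Polynomial z t h →
             Polynomial z (s ℕ.+ t) (λ y → g y * h y)
    neg    : ∀ {t g} → Polynomial z t g → Polynomial z t (λ y → - g y)

  polynomial-^ : ∀ {v y} {V : Set v} {Y : Set y} {z : V → Y → Carrier} {t g} →
                 Polynomial z t g → ∀ k → Polynomial z (k ℕ.* t) (λ y → g y ^ k)
  polynomial-^ g zero    = const 1#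
  polynomial-^ g (suc k) = g ⊗ polynomial-^ g k

  polynomial-sum : ∀ {v y} {V : Set v} {Y : Set y} {z : V → Y → Carrier} {t n}
                   {g : Fin n → Y → Carrier} → (∀ i → Polynomial z t (g i)) →
                   Polynomial z t (λ y → sum (λ i → g i y))
  polynomial-sum {n = zero}  g = weaken z≤n (const 0#)
  polynomial-sum {n = suc n} g = g zeroᶠ ⊕ polynomial-sum (g ∘ sucᶠ)

  polynomial-product : ∀ {v y} {V : Set v} {Y : Set y} {z : V → Y → Carrier} {t n}
                       {g : Fin n → Y → Carrier} → (∀ i → Polynomial z t (g i)) →
                       Polynomial z (n ℕ.* t) (λ y → product (λ i → g i y))
  polynomial-product {n = zero}  g = const 1#
  polynomial-product {n = suc n} g = g zeroᶠ ⊗ polynomial-product (g ∘ sucᶠ)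

  -- Expansion of polynomials in the coordinates of two points.

  module _ {x} {X : Set x} {n} (p : X → Vector Carrier n) where

    coordinate : Fin n ⊎ Fin n → X × X → Carrier
    coordinate (inj₁ i) (x , y) = p x i
    coordinate (inj₂ i) (x , y) = p y i

    bimonomial : Vec ℕ n → Vec ℕ n → X × X → Carrier
    bimonomial e f (x , y) = monomial (p x) e * monomial (p y) f

    -- Induction on the polynomial replaces its expansion into monomials. The bimonomial in front is
    -- an accumulator of degree at most `s`: a variable is absorbed by raising one of its exponents,
    -- sums and constants by the closure of `P`. No normal form of polynomials is needed.
    polynomial∈subspace :
      ∀ {a} {P : Pred (X × X → Carrier) a} → IsSubspace P → ∀ {t h} →
      Polynomial coordinate t h → ∀ s →
      (∀ e f → Vec.sum e ℕ.+ Vec.sum f ℕ.≤ t ℕ.+ s → P (bimonomial e f)) →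
      ∀ e f → Vec.sum e ℕ.+ Vec.sum f ℕ.≤ s → P (λ z → bimonomial e f z * h z)
    polynomial∈subspace S (const a) s P∋ e f d≤s =
      respects (λ _ → *-comm a _) (*-closed a (P∋ e f d≤s))
      where open IsSubspace S
    polynomial∈subspace S (var (inj₁ i)) s P∋ e f d≤s =
      respects
        (λ (x , y) → begin
          monomial (p x) (Vec.updateAt e i suc) * monomial (p y) f
            ≈⟨ *-congʳ (monomial-updateAt (p x) e i) ⟩
          (p x i * monomial (p x) e) * monomial (p y) f
            ≈⟨ *-assoc _ _ _ ⟩
          p x i * bimonomial e f (x , y)
            ≈⟨ *-comm _ _ ⟩
          bimonomial e f (x , y) * p x i ∎)
        (P∋ (Vec.updateAt e i suc) f
          (≡.subst (λ k → k ℕ.+ Vec.sum f ℕ.≤ suc s) (≡.sym (sum-updateAt e i)) (s≤s d≤s)))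
      where open IsSubspace S
    polynomial∈subspace S (var (inj₂ i)) s P∋ e f d≤s =
      respects
        (λ (x , y) → begin
          monomial (p x) e * monomial (p y) (Vec.updateAt f i suc)
            ≈⟨ *-congˡ (monomial-updateAt (p y) f i) ⟩
          monomial (p x) e * (p y i * monomial (p y) f)
            ≈⟨ x∙yz≈y∙xz _ _ _ ⟩
          p y i * bimonomial e f (x , y)
            ≈⟨ *-comm _ _ ⟩
          bimonomial e f (x , y) * p y i ∎)
        (P∋ e (Vec.updateAt f i suc)
          (≡.subst (ℕ._≤ suc s)
            (≡.sym (≡.trans (≡.cong (Vec.sum e ℕ.+_) (sum-updateAt f i)) (ℕ.+-suc (Vec.sum e) _)))
            (s≤s d≤s)))
      where open IsSubspace S
    polynomial∈subspace S (weaken t≤t′ h) s P∋ =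
      polynomial∈subspace S h s
        (λ e f d≤ → P∋ e f (ℕ.≤-trans d≤ (ℕ.+-monoˡ-≤ s t≤t′)))
    polynomial∈subspace S (g ⊕ h) s P∋ e f d≤s =
      respects (λ _ → sym (distribˡ _ _ _))
        (+-closed (polynomial∈subspace S g s P∋ e f d≤s) (polynomial∈subspace S h s P∋ e f d≤s))
      where open IsSubspace S
    polynomial∈subspace {P = P} S (_⊗_ {s = t₁} {t = t₂} {g = g} {h = h} G H) s P∋ e f d≤s =
      respects (λ _ → *-assoc _ _ _)
        -- The left factor is expanded for the subspace of functions whose product with `h` lies in
        -- `P`. What remains is a bimonomial of degree at most `t₁ + s` times `h`, which is the
        -- claim for the right factor.
        (polynomial∈subspace S∙h G s
          (λ e f d≤ → polynomial∈subspace S H (t₁ ℕ.+ s)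
            (λ e f d≤ → P∋ e f (ℕ.≤-trans d≤ (ℕ.≤-reflexive
              (≡.trans (≡.sym (ℕ.+-assoc t₂ t₁ s)) (≡.cong (ℕ._+ s) (ℕ.+-comm t₂ t₁))))))
            e f d≤)
          e f d≤s)
      where
      open IsSubspace S
      S∙h : IsSubspace (λ u → P (λ z → u z * h z))
      S∙h = record
        { respects = λ u≈v → respects (λ z → *-congʳ (u≈v z))
        ; zero∈    = respects (λ z → sym (zeroˡ (h z))) zero∈
        ; +-closed = λ Pu Pv → respects (λ z → sym (distribʳ _ _ _)) (+-closed Pu Pv)
        ; *-closed = λ a Pu → respects (λ z → sym (*-assoc _ _ _)) (*-closed a Pu)
        }
    polynomial∈subspace S (neg h) s P∋ e f d≤s =
      respects (λ _ → trans (x∙yz≈y∙xz _ _ _) (*-congˡ (-1*x≈-x _)))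
        (*-closed (- 1#) (polynomial∈subspace S h s P∋ e f d≤s))
      where open IsSubspace S

  -- Half of the degree of a bimonomial falls on one of its two factors.
  biannihilates-polynomial :
    ∀ {m n s} (p : Fin m → Vector Carrier n) (w : Vector Carrier m) →
    (∀ e → Vec.sum e ℕ.≤ s → w ∙ (λ i → monomial (p i) e) ≈ 0#) →
    ∀ {h} → Polynomial (coordinate p) (s ℕ.+ s) h →
    w ∙ (λ i → w ∙ (λ j → h (i , j))) ≈ 0#
  biannihilates-polynomial {n = n} {s = s} p w w⊥ {h} H =
    -- The accumulator starts with all exponents zero, where the bimonomial is 1 and the product is
    -- `h` itself.
    respects (λ (i , j) → trans (*-congʳ (*-cong (monomial-0 (p i)) (monomial-0 (p j))))
                                (trans (*-congʳ (*-identityˡ 1#)) (*-identityˡ _)))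
      (polynomial∈subspace p (biannihilated-isSubspace w) H 0 w⊥⊥
        (Vec.replicate n 0) (Vec.replicate n 0)
        (ℕ.≤-reflexive (≡.cong₂ ℕ._+_ (sum-0 n) (sum-0 n))))
    where
    open IsSubspace (biannihilated-isSubspace w)
    factor : ∀ e f → w ∙ (λ i → w ∙ (λ j → bimonomial p e f (i , j))) ≈
                     w ∙ (λ i → monomial (p i) f) * w ∙ (λ i → monomial (p i) e)
    factor e f = trans
      (∙-congˡ w (λ i → trans (∙-* w (monomial (p i) e) _) (*-comm _ _)))
      (∙-* w _ _)
    w⊥⊥ : ∀ e f → Vec.sum e ℕ.+ Vec.sum f ℕ.≤ s ℕ.+ s ℕ.+ 0 →
          w ∙ (λ i → w ∙ (λ j → bimonomial p e f (i , j))) ≈ 0#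
    w⊥⊥ e f d≤ with Vec.sum e ℕ.≤? s
    ... | yes e≤s = trans (factor e f) (trans (*-congˡ (w⊥ e e≤s)) (zeroʳ _))
    ... | no  e≰s = trans (factor e f) (trans (*-congʳ (w⊥ f f≤s)) (zeroˡ _))
      where
      f≤s : Vec.sum f ℕ.≤ s
      f≤s = ℕ.+-cancelˡ-≤ s _ _ (ℕ.≤-trans
        (ℕ.+-monoˡ-≤ (Vec.sum f) (ℕ.<⇒≤ (ℕ.≰⇒> e≰s)))
        (ℕ.≤-trans d≤ (ℕ.≤-reflexive (ℕ.+-identityʳ (s ℕ.+ s)))))

  -- Reduction of exponents on a finite grid.

  product-zero : ∀ {k} (a : Vector Carrier k) i → a i ≈ 0# → product a ≈ 0#
  product-zero a zeroᶠ    ai≈0 = trans (*-congʳ ai≈0) (zeroˡ _)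
  product-zero a (sucᶠ i) ai≈0 = trans (*-congˡ (product-zero (tail a) i ai≈0)) (zeroʳ _)

  module _ {y p} {Y : Set y} {P : Pred (Y → Carrier) p} (S : IsSubspace P) where
    open IsSubspace S

    -- The product of the `x - aᵢ` is monic of degree `k`, so it differs from the `k`-th power by
    -- lower powers. Its coefficients are avoided by peeling off one root at a time: x^(k+1) = (x -
    -- a₀) x^k + a₀ x^k, with the factor `x - a₀` absorbed into `h`.
    leading-power : ∀ {k} (a : Vector Carrier k) (x h : Y → Carrier) →
      (∀ j → j ℕ.< k → P (λ z → h z * x z ^ j)) →
      P (λ z → h z * product (λ i → x z - a i)) → P (λ z → h z * x z ^ k)
    leading-power {zero}  a x h lower prod = prod
    leading-power {suc k} a x h lower prod =
      respects
        (λ z → trans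
          (solve 4 (λ h y a X → (h :* y) :* X :+ a :* (h :* X) := h :* ((y :+ a) :* X)) refl
            (h z) (x z - a₀) a₀ (x z ^ k))
          (*-congˡ (*-congʳ (//-rightDividesˡ a₀ (x z)))))
        (+-closed
          (leading-power (tail a) x (λ z → h z * (x z - a₀)) lower′
            (respects (λ z → sym (*-assoc _ _ _)) prod))
          (*-closed a₀ (lower k ℕ.≤-refl)))
      where
      a₀ : Carrier
      a₀ = a zeroᶠ
      lower′ : ∀ j → j ℕ.< k → P (λ z → (h z * (x z - a₀)) * x z ^ j)
      lower′ j j<k = respects
        (λ z → solve 4 (λ h x b X → h :* (x :* X) :+ b :* (h :* X) := (h :* (x :+ b)) :* X) refl
          (h z) (x z) (- a₀) (x z ^ j))
        (+-closed (lower (suc j) (s≤s j<k)) (*-closed (- a₀) (lower j (ℕ.m<n⇒m<1+n j<k))))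

    -- Where `x` takes only the values `aᵢ`, the product of the `x - aᵢ` vanishes, so each power
    -- from the `k`-th on is a combination of smaller ones. The bound `b` records that exponents
    -- only decrease, which controls total degrees later.
    all-powers : ∀ {k} (a : Vector Carrier k) (x h : Y → Carrier) →
      (∀ z → ∃[ i ] x z ≈ a i) → ∀ b →
      (∀ j → j ℕ.< k → j ℕ.≤ b → P (λ z → h z * x z ^ j)) →
      ∀ j → j ℕ.≤ b → P (λ z → h z * x z ^ j)
    all-powers {k} a x h x∈a b lower = ℕ.<-rec _ step
      where
      product≈0 : ∀ z → product (λ i → x z - a i) ≈ 0#
      product≈0 z = let i , x≈a = x∈a z in
        product-zero (λ i → x z - a i) i (trans (+-congʳ x≈a) (-‿inverseʳ (a i)))
      step : ∀ j → (∀ {i} → i ℕ.< j → i ℕ.≤ b → P (λ z → h z * x z ^ i)) →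
             j ℕ.≤ b → P (λ z → h z * x z ^ j)
      step j rec j≤b with k ℕ.≤? j
      ... | no  k≰j = lower j (ℕ.≰⇒> k≰j) j≤b
      -- Splitting x^j as x^(j-k) x^k and moving the first factor into `h` leaves exactly the `k`-th
      -- power to reduce.
      ... | yes k≤j = ≡.subst (λ j → P (λ z → h z * x z ^ j)) (ℕ.m∸n+n≡m k≤j)
        (respects (shift k)
          (leading-power a x (λ z → h z * x z ^ (j ℕ.∸ k))
            (λ i i<k →
              let l<j : j ℕ.∸ k ℕ.+ i ℕ.< j
                  l<j = ℕ.<-≤-trans (ℕ.+-monoʳ-< (j ℕ.∸ k) i<k) (ℕ.≤-reflexive (ℕ.m∸n+n≡m k≤j))
              in respects (λ z → sym (shift i z)) (rec l<j (ℕ.≤-trans (ℕ.<⇒≤ l<j) j≤b)))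
            (respects (λ z → sym (trans (*-congˡ (product≈0 z)) (zeroʳ _))) zero∈)))
        where
        shift : ∀ i z → (h z * x z ^ (j ℕ.∸ k)) * x z ^ i ≈ h z * x z ^ (j ℕ.∸ k ℕ.+ i)
        shift i z = trans (*-assoc _ _ _) (*-congˡ (sym (^-homo-* (x z) (j ℕ.∸ k) i)))

    -- Coordinates are reduced one after another; `g` collects the powers of those already treated.
    all-monomials : ∀ {n q} (a : Fin n → Vector Carrier q) (x : Y → Vector Carrier n) →
      (∀ z i → ∃[ l ] x z i ≈ a i l) → ∀ (g : Y → Carrier) s →
      (∀ e → VecAll.All (ℕ._< q) e → Vec.sum e ℕ.≤ s → P (λ z → g z * monomial (x z) e)) →
      ∀ e → Vec.sum e ℕ.≤ s → P (λ z → g z * monomial (x z) e)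
    all-monomials a x x∈a g s reduced []      d≤s = reduced [] [] d≤s
    all-monomials a x x∈a g s reduced (k ∷ e) d≤s =
      respects (λ z → trans (xy∙z≈xz∙y _ _ _) (*-assoc _ _ _))
        (all-powers (a zeroᶠ) (λ z → x z zeroᶠ) (λ z → g z * monomial (tail (x z)) e)
          (λ z → x∈a z zeroᶠ) k
          (λ j j<q j≤k → respects (λ z → xy∙z≈xz∙y _ _ _)
            -- The degree allowed for the tail is that of `e` rather than `s`: with `j ≤ k` in
            -- front, the total stays at most the original degree.
            (all-monomials (tail a) (tail ∘ x) (λ z → x∈a z ∘ sucᶠ)
              (λ z → g z * x z zeroᶠ ^ j) (Vec.sum e)
              (λ f f<q f≤e → respects (λ z → sym (*-assoc _ _ _))
                (reduced (j ∷ f) (j<q ∷ f<q) (ℕ.≤-trans (ℕ.+-mono-≤ j≤k f≤e) d≤s)))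
              e ℕ.≤-refl))
          k ℕ.≤-refl)

  -- Generating functions of exponent vectors by degree.

  listSum : ∀ {a} {A : Set a} → (A → Carrier) → List A → Carrier
  listSum f []       = 0#
  listSum f (x ∷ xs) = f x + listSum f xs

  listSum-++ : ∀ {a} {A : Set a} (f : A → Carrier) xs ys →
               listSum f (xs List.++ ys) ≈ listSum f xs + listSum f ys
  listSum-++ f []       ys = sym (+-identityˡ _)
  listSum-++ f (x ∷ xs) ys = trans (+-congˡ (listSum-++ f xs ys)) (sym (+-assoc _ _ _))

  -- The value of the monomial with exponents `e` when every variable equals `x`. Summed over a list
  -- of exponent vectors, it gives their generating function by degree.
  weight : Carrier → ∀ {n} → Vec ℕ n → Carrier
  weight x e = x ^ Vec.sum e

  listSum-weight-map : ∀ x {n} k (es : List (Vec ℕ n)) →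
    listSum (weight x) (List.map (k ∷_) es) ≈ x ^ k * listSum (weight x) es
  listSum-weight-map x k []       = sym (zeroʳ _)
  listSum-weight-map x k (e ∷ es) = begin
    x ^ (k ℕ.+ Vec.sum e) + listSum (weight x) (List.map (k ∷_) es)
      ≈⟨ +-cong (^-homo-* x k (Vec.sum e)) (listSum-weight-map x k es) ⟩
    x ^ k * weight x e + x ^ k * listSum (weight x) es
      ≈⟨ distribˡ _ _ _ ⟨
    x ^ k * (weight x e + listSum (weight x) es) ∎

  listSum-weight-product : ∀ x {n} ks (es : List (Vec ℕ n)) →
    listSum (weight x) (List.cartesianProductWith _∷_ ks es) ≈
    listSum (x ^_) ks * listSum (weight x) es
  listSum-weight-product x []       es = sym (zeroˡ _)
  listSum-weight-product x (k ∷ ks) es = begin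
    listSum (weight x) (List.map (k ∷_) es List.++ List.cartesianProductWith _∷_ ks es)
      ≈⟨ listSum-++ (weight x) (List.map (k ∷_) es) _ ⟩
    listSum (weight x) (List.map (k ∷_) es) +
    listSum (weight x) (List.cartesianProductWith _∷_ ks es)
      ≈⟨ +-cong (listSum-weight-map x k es) (listSum-weight-product x ks es) ⟩
    x ^ k * listSum (weight x) es + listSum (x ^_) ks * listSum (weight x) es
      ≈⟨ distribʳ _ _ _ ⟨
    (x ^ k + listSum (x ^_) ks) * listSum (weight x) es ∎

  -- `downFrom q` runs from q - 1 to 0, so this is the geometric sum; the induction splits off its
  -- highest power, and the sum telescopes. Multiplying by `1# - x` avoids a division.
  listSum-geometric : ∀ x q →
                      listSum (x ^_) (List.downFrom q) * (1# - x) ≈ 1# - x ^ q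
  listSum-geometric x zero    = trans (zeroˡ _) (sym (-‿inverseʳ 1#))
  listSum-geometric x (suc q) = begin
    (x ^ q + listSum (x ^_) (List.downFrom q)) * (1# - x)
      ≈⟨ distribʳ _ _ _ ⟩
    x ^ q * (1# - x) + listSum (x ^_) (List.downFrom q) * (1# - x)
      ≈⟨ +-cong (distribˡ _ _ _) (listSum-geometric x q) ⟩
    (x ^ q * 1# + x ^ q * - x) + (1# - x ^ q)
      ≈⟨ +-congʳ (+-cong (*-identityʳ _) (sym (-‿distribʳ-* _ _))) ⟩
    (x ^ q - x ^ q * x) + (1# - x ^ q)
      ≈⟨ solve 4 (λ X -Xx o -X → (X :+ -Xx) :+ (o :+ -X) := (X :+ -X) :+ (o :+ -Xx)) refl
           (x ^ q) (- (x ^ q * x)) 1# (- x ^ q) ⟩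
    (x ^ q - x ^ q) + (1# - x ^ q * x)
      ≈⟨ +-cong (-‿inverseʳ _) (+-congˡ (-‿cong (*-comm _ _))) ⟩
    0# + (1# - x ^ suc q)
      ≈⟨ +-identityˡ _ ⟩
    1# - x ^ suc q ∎

-- Enumeration of the reduced exponent vectors.

vectorsBelow : ℕ → ∀ n → List (Vec ℕ n)
vectorsBelow q zero    = [] ∷ []
vectorsBelow q (suc n) = List.cartesianProductWith _∷_ (List.downFrom q) (vectorsBelow q n)

∈-vectorsBelow : ∀ {q n} {e : Vec ℕ n} → VecAll.All (ℕ._< q) e → e ∈ vectorsBelow q n
∈-vectorsBelow []          = here ≡.refl
∈-vectorsBelow (k<q ∷ e<q) =
  ∈-cartesianProductWith⁺ _∷_ (∈-downFrom⁺ k<q) (∈-vectorsBelow e<q)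

sumAtMost : ℕ → ∀ {n} → List (Vec ℕ n) → List (Vec ℕ n)
sumAtMost s = List.filter (λ e → Vec.sum e ℕ.≤? s)

module RealSpaces {c ℓ₁ ℓ₂} (ℝ : CompleteOrderedField c ℓ₁ ℓ₂) where
  open Reals ℝ
  open PolynomialFunctions commutativeRing
  open import Algebra.Definitions.RawSemiring (Semiring.rawSemiring semiring) using (product)
  open import Algebra.Properties.AbelianGroup +-abelianGroup
    using () renaming (x∙y⁻¹≈ε⇒x≈y to x-y≈0⇒x≈y)
  open import Algebra.Properties.CommutativeSemiring.Exp commutativeSemiring
    using (^-assocʳ; ^-distrib-*; ^-congʳ)
  open import Algebra.Properties.Monoid.Sum *-monoid
    using () renaming (sum-cong-≋ to product-cong)
  open import Algebra.Properties.Semiring.Sum semiring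
    using (sum-remove; sum-cong-≋; *-distribʳ-sum)
  open import Relation.Binary.Reasoning.Setoid setoid

  -- Cancellation and sums of squares in the ordered field.

  inv-inverseʳ : ∀ {x} (x≉0 : x ≉ 0#) → x * inv x x≉0 ≈ 1#
  inv-inverseʳ {x} x≉0 = proj₂ (inverse x x≉0)

  x*y*inv≈x : ∀ x {y} (y≉0 : y ≉ 0#) → (x * y) * inv y y≉0 ≈ x
  x*y*inv≈x x y≉0 =
    trans (*-assoc _ _ _) (trans (*-congˡ (inv-inverseʳ y≉0)) (*-identityʳ x))

  x*inv*y≈x : ∀ x {y} (y≉0 : y ≉ 0#) → (x * inv y y≉0) * y ≈ x
  x*inv*y≈x x y≉0 = trans (*-assoc _ _ _)
    (trans (*-congˡ (trans (*-comm _ _) (inv-inverseʳ y≉0))) (*-identityʳ x))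

  x*y≈0⇒x≈0 : ∀ {x y} → y ≉ 0# → x * y ≈ 0# → x ≈ 0#
  x*y≈0⇒x≈0 {x} y≉0 xy≈0 =
    trans (sym (x*y*inv≈x x y≉0)) (trans (*-congʳ xy≈0) (zeroˡ _))

  x^2≈0⇒x≈0 : ∀ {x} → x ^ 2 ≈ 0# → x ≈ 0#
  x^2≈0⇒x≈0 {x} x²≈0 = decidable-stable (x ≟ 0#)
    (λ x≉0 → x≉0 (x*y≈0⇒x≈0 x≉0 (trans (*-congˡ (sym (*-identityʳ x))) x²≈0)))

  product-≉0 : ∀ {k} (a : Vector Carrier k) → (∀ i → a i ≉ 0#) → product a ≉ 0#
  product-≉0 {zero}  a a≉0 = 0≉1 ∘ sym
  product-≉0 {suc k} a a≉0 aP≈0 =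
    a≉0 zeroᶠ (x*y≈0⇒x≈0 (product-≉0 (tail a) (a≉0 ∘ sucᶠ)) aP≈0)

  nonNegative-sum≈0 : ∀ {n} (v : Vector Carrier n) → (∀ i → 0# ≤ v i) →
                      sum v ≈ 0# → ∀ i → v i ≈ 0#
  nonNegative-sum≈0 {suc n} v 0≤v Σ≈0 i = antisym
    (≤-respʳ-≈ Σ≈0 (≤-respʳ-≈ (sym (sum-remove v))
      (≤-respˡ-≈ (+-identityʳ (v i))
        (+-monoʳ-≤ (v i) (sum-nonNegative (removeAt v i) (λ j → 0≤v (punchIn i j)))))))
    (0≤v i)

  -- Positive definiteness: it turns the vanishing of the quadratic form of a nonzero scalar matrix
  -- into `w = 0`, and makes points at distance zero coincide.
  sumSquares≈0 : ∀ {n} (v : Vector Carrier n) → sum (λ i → v i ^ 2) ≈ 0# →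
                 ∀ i → v i ≈ 0#
  sumSquares≈0 v Σ≈0 i = x^2≈0⇒x≈0
    (nonNegative-sum≈0 (λ i → v i ^ 2) (λ i → square-nonNegative (v i)) Σ≈0 i)

  -- Linear systems and the dimension argument.

  ∙-diagonal : ∀ {m} (w u : Vector Carrier m) i → (∀ j → ¬ i ≡ j → u j ≈ 0#) →
               w ∙ u ≈ w i * u i
  ∙-diagonal {suc m} w u i u≈0 = begin
    w ∙ u
      ≈⟨ sum-remove (λ j → w j * u j) ⟩
    w i * u i + removeAt w i ∙ removeAt u i
      ≈⟨ +-congˡ (∙-zeroʳ (removeAt w i) (λ j → u≈0 (punchIn i j) (punchInᵢ≢i i j ∘ ≡.sym))) ⟩
    w i * u i + 0#
      ≈⟨ +-identityʳ _ ⟩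
    w i * u i ∎

  ∙-insertAt : ∀ {m} (w : Vector Carrier m) i b u →
               insertAt w i b ∙ u ≈ b * u i + w ∙ removeAt u i
  ∙-insertAt w i b u = trans (sum-remove {i = i} (λ j → insertAt w i b j * u j))
    (+-cong (*-congʳ (reflexive (insertAt-lookup w i b)))
            (sum-cong-≋ (λ j → *-congʳ (reflexive (insertAt-punchIn w i b j)))))

  -- Gaussian elimination on the first equation: if all its coefficients vanish it is dropped,
  -- otherwise a nonzero coefficient serves as pivot and removes one equation together with one
  -- unknown.
  underdetermined : ∀ {r m} → r ℕ.< m → (us : Vector (Vector Carrier m) r) →
                    ∃[ w ] ((∃[ i ] w i ≉ 0#) × (∀ k → w ∙ us k ≈ 0#))
  underdetermined {zero}  {suc m} _         us = (λ _ → 1#) , (zeroᶠ , 0≉1 ∘ sym) , λ ()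
  underdetermined {suc r} {suc m} (s≤s r<m) us with any? (λ i → ¬? (us zeroᶠ i ≟ 0#))
  ... | no u≈0 =
    let w , w≉0 , w⊥ = underdetermined (ℕ.m<n⇒m<1+n r<m) (tail us)
    in w , w≉0 , λ where
         zeroᶠ    → ∙-zeroʳ w λ i →
           decidable-stable (us zeroᶠ i ≟ 0#) (λ u≉0 → u≈0 (i , u≉0))
         (sucᶠ k) → w⊥ k
  ... | yes (i , ui≉0) =
    let w , (j , wj≉0) , w⊥ = underdetermined r<m (eliminate ∘ tail us)
    in insertAt w i (b w)
     , (punchIn i j , λ ≈0 → wj≉0
         (trans (reflexive (≡.sym (insertAt-punchIn w i (b w) j))) ≈0))
     , λ where
         zeroᶠ    → u⊥ w
         (sucᶠ k) → v⊥ w (us (sucᶠ k)) (w⊥ k)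
    where
    u : Vector Carrier (suc m)
    u = us zeroᶠ
    u⁻¹ : Carrier
    u⁻¹ = inv (u i) ui≉0
    u′ : Vector Carrier m
    u′ = removeAt u i
    -- The value of the pivot unknown that the first equation forces once the others are given by
    -- `w`.
    b : Vector Carrier m → Carrier
    b w = - (u⁻¹ * w ∙ u′)
    -- The multiple of the first equation that clears the pivot column is subtracted, and that
    -- column deleted.
    eliminate : Vector Carrier (suc m) → Vector Carrier m
    eliminate v k = removeAt v i k + - (v i * u⁻¹) * u′ k
    u⊥ : ∀ w → insertAt w i (b w) ∙ u ≈ 0#
    u⊥ w = begin
      insertAt w i (b w) ∙ u                 ≈⟨ ∙-insertAt w i (b w) u ⟩
      - (u⁻¹ * w ∙ u′) * u i + w ∙ u′        ≈⟨ +-congʳ (-‿distribˡ-* _ _) ⟨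
      - ((u⁻¹ * w ∙ u′) * u i) + w ∙ u′
        ≈⟨ +-congʳ (-‿cong (trans (*-congʳ (*-comm _ _)) (x*inv*y≈x _ ui≉0))) ⟩
      - (w ∙ u′) + w ∙ u′                    ≈⟨ -‿inverseˡ _ ⟩
      0#                                     ∎
    v⊥ : ∀ w v → w ∙ eliminate v ≈ 0# → insertAt w i (b w) ∙ v ≈ 0#
    v⊥ w v w⊥v = begin
      insertAt w i (b w) ∙ v
        ≈⟨ ∙-insertAt w i (b w) v ⟩
      - (u⁻¹ * w ∙ u′) * v i + w ∙ removeAt v i
        ≈⟨ +-comm _ _ ⟩
      w ∙ removeAt v i + - (u⁻¹ * w ∙ u′) * v i
        ≈⟨ +-congˡ (begin
             - (u⁻¹ * w ∙ u′) * v i     ≈⟨ -‿distribˡ-* _ _ ⟨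
             - ((u⁻¹ * w ∙ u′) * v i)   ≈⟨ -‿cong (*-comm _ _) ⟩
             - (v i * (u⁻¹ * w ∙ u′))   ≈⟨ -‿cong (*-assoc _ _ _) ⟨
             - ((v i * u⁻¹) * w ∙ u′)   ≈⟨ -‿distribˡ-* _ _ ⟩
             - (v i * u⁻¹) * w ∙ u′     ≈⟨ ∙-* w _ _ ⟨
             w ∙ (λ k → - (v i * u⁻¹) * u′ k) ∎) ⟩
      w ∙ removeAt v i + w ∙ (λ k → - (v i * u⁻¹) * u′ k)
        ≈⟨ ∙-+ w _ _ ⟨
      w ∙ eliminate v
        ≈⟨ w⊥v ⟩
      0# ∎

  -- With fewer reduced monomials than points, some nonzero `w` is orthogonal to all of them, hence
  -- by reduction on the grid to every monomial of degree at most `s`. Then the quadratic form of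
  -- `h` vanishes at `w`; but it equals `c` times the sum of the squares of `w`, a contradiction.
  scalarMatrix-bound :
    ∀ {m n q s c} (a : Fin n → Vector Carrier q) (p : Fin m → Vector Carrier n) →
    (∀ i j → ∃[ l ] p i j ≈ a j l) →
    ∀ {h} → Polynomial (coordinate p) (s ℕ.+ s) h → c ≉ 0# →
    (∀ i → h (i , i) ≈ c) → (∀ i j → ¬ i ≡ j → h (i , j) ≈ 0#) →
    m ℕ.≤ length (sumAtMost s (vectorsBelow q n))
  scalarMatrix-bound {m} {n} {q} {s} {c} a p p∈a {h} H c≉0 diagonal offDiagonal =
    ℕ.≮⇒≥ λ r<m →
      let w , (i , wi≉0) , w⊥ = underdetermined r<m (monomials ∘ List.lookup reduced)
      in wi≉0 (w≈0 w w⊥ i)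
    where
    reduced : List (Vec ℕ n)
    reduced = sumAtMost s (vectorsBelow q n)
    monomials : Vec ℕ n → Vector Carrier m
    monomials e i = monomial (p i) e
    w≈0 : ∀ w → (∀ k → w ∙ monomials (List.lookup reduced k) ≈ 0#) → ∀ i → w i ≈ 0#
    w≈0 w w⊥ = sumSquares≈0 w (x*y≈0⇒x≈0 c≉0 (begin
        sum (λ i → w i ^ 2) * c
          ≈⟨ *-distribʳ-sum c (λ i → w i ^ 2) ⟩
        sum (λ i → w i ^ 2 * c)
          ≈⟨ sum-cong-≋ (λ i → begin
               w i ^ 2 * c
                 ≈⟨ *-congʳ (*-congˡ (*-identityʳ (w i))) ⟩
               (w i * w i) * c
                 ≈⟨ *-assoc _ _ _ ⟩
               w i * (w i * c)
                 ≈⟨ *-congˡ (*-congˡ (diagonal i)) ⟨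
               w i * (w i * h (i , i))
                 ≈⟨ *-congˡ (∙-diagonal w (λ j → h (i , j)) i (offDiagonal i)) ⟨
               w i * w ∙ (λ j → h (i , j)) ∎) ⟩
        w ∙ (λ i → w ∙ (λ j → h (i , j)))
          ≈⟨ biannihilates-polynomial p w monomial⊥ H ⟩
        0# ∎))
      where
      open IsSubspace (annihilated-isSubspace w)
      reduced⊥ : ∀ {e} → e ∈ reduced → w ∙ monomials e ≈ 0#
      reduced⊥ e∈ = ≡.subst (λ e → w ∙ monomials e ≈ 0#) (≡.sym (lookup-index e∈))
                            (w⊥ (index e∈))
      monomial⊥ : ∀ e → Vec.sum e ℕ.≤ s → w ∙ monomials e ≈ 0#
      monomial⊥ e e≤s = respects (λ _ → *-identityˡ _)
        (all-monomials (annihilated-isSubspace w) a p p∈a (λ _ → 1#) s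
          (λ e e<q e≤s → respects (λ _ → sym (*-identityˡ _))
            (reduced⊥ (∈-filter⁺ (λ e → Vec.sum e ℕ.≤? s) (∈-vectorsBelow e<q) e≤s)))
          e e≤s)

  -- Sets with few distances.

  distance^2 : ∀ {n} (x y : Vector Carrier n) → distance x y ^ 2 ≈ squaredDistance x y
  distance^2 x y = proj₂ (proj₂ (rootExists 2 _))

  squaredDistance-self : ∀ {n} (x : Vector Carrier n) → squaredDistance x x ≈ 0#
  squaredDistance-self {zero}  x = refl
  squaredDistance-self {suc n} x = trans
    (+-cong (trans (*-congʳ (-‿inverseʳ _)) (zeroˡ _)) (squaredDistance-self (tail x)))
    (+-identityˡ 0#)

  squaredDistance≈0 : ∀ {n} (x y : Vector Carrier n) → squaredDistance x y ≈ 0# →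
                      ∀ i → x i ≈ y i
  squaredDistance≈0 x y ≈0 i = x-y≈0⇒x≈y (x i) (y i) (sumSquares≈0 (λ i → x i - y i) ≈0 i)

  -- Applied to the product over all distances `D l` of |x - y|² - (D l)². Distances are squared so
  -- that each factor is a polynomial, of degree 2.
  fewDistances-bound :
    ∀ {n q s k m f} (a : Fin n → Vector Carrier q) (F : Pred (Vector Carrier n) f) →
    (∀ {x} → F x → ∀ i → ∃[ l ] x i ≈ a i l) →
    HasCardinality setoid (distances F) k → k ℕ.≤ s →
    HasCardinality (vectorSetoid n) F m →
    m ℕ.≤ length (sumAtMost s (vectorsBelow q n))
  fewDistances-bound {n} {s = s} {k} {m} a F F⊆a ds k≤s pts =
    scalarMatrix-bound a p (λ i → F⊆a (proj₂ (Pts.to i)))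
      (weaken (≡.subst (ℕ._≤ s ℕ.+ s) (≡.sym k*2≡k+k) (ℕ.+-mono-≤ k≤s k≤s))
        (polynomial-product (λ l → polynomial-sum squares ⊕ weaken z≤n (const (- D² l)))))
      c≉0
      (λ i → product-cong {k} (λ l → +-congʳ (squaredDistance-self (p i))))
      offDiagonal
    where
    module Pts = Bijection pts
    module Ds = Bijection ds
    p : Fin m → Vector Carrier n
    p i = proj₁ (Pts.to i)
    D D² : Fin k → Carrier
    D l  = proj₁ (Ds.to l)
    D² l = D l ^ 2
    k*2≡k+k : k ℕ.* 2 ≡ k ℕ.+ k
    k*2≡k+k = ≡.trans (ℕ.*-comm k 2) (≡.cong (k ℕ.+_) (ℕ.+-identityʳ k))
    squares : ∀ i → Polynomial (coordinate p) 2 (λ (x , y) → (p x i - p y i) ^ 2)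
    squares i = polynomial-^ (var (inj₁ i) ⊕ neg (var (inj₂ i))) 2
    c≉0 : product (λ l → 0# - D² l) ≉ 0#
    c≉0 = product-≉0 _ λ l 0-D²≈0 →
      -- A vanishing factor on the diagonal would be a distance 0 between two distinct points.
      let x , y , _ , _ , x≉y , D≈d = proj₂ (Ds.to l)
      in x≉y (squaredDistance≈0 x y (begin
        squaredDistance x y   ≈⟨ distance^2 x y ⟨
        distance x y ^ 2      ≈⟨ ^-congˡ 2 D≈d ⟨
        D² l                  ≈⟨ x-y≈0⇒x≈y 0# (D² l) 0-D²≈0 ⟨
        0#                    ∎))
    offDiagonal : ∀ i j → ¬ i ≡ j →
                  product (λ l → squaredDistance (p i) (p j) - D² l) ≈ 0#
    offDiagonal i j i≢j =
      let d = distance (p i) (p j)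
          -- Different indices give different points, so their distance is listed as some `D l`, and
          -- the factor of that `l` vanishes.
          l , surjective = Ds.surjective (d , p i , p j , proj₂ (Pts.to i) , proj₂ (Pts.to j)
                                           , i≢j ∘ Pts.injective , refl)
      in product-zero _ l (begin
        squaredDistance (p i) (p j) - D² l
          ≈⟨ +-cong (distance^2 (p i) (p j)) (-‿cong (^-congˡ 2 (sym (surjective ≡.refl)))) ⟨
        d ^ 2 - d ^ 2
          ≈⟨ -‿inverseʳ _ ⟩
        0# ∎)

  -- Counting the reduced monomials.

  listSum-weight-vectorsBelow : ∀ x q n →
    listSum (weight x) (vectorsBelow q n) ≈ listSum (x ^_) (List.downFrom q) ^ n
  listSum-weight-vectorsBelow x q zero    = +-identityʳ 1#
  listSum-weight-vectorsBelow x q (suc n) =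
    trans (listSum-weight-product x (List.downFrom q) (vectorsBelow q n))
          (*-congˡ (listSum-weight-vectorsBelow x q n))

  ^-antitone : ∀ {x j k} → 0# ≤ x → x ≤ 1# → j ℕ.≤ k → x ^ k ≤ x ^ j
  ^-antitone {x} {k = k} 0≤x x≤1 z≤n =
    ≤-respʳ-≈ (1^k≈1 k) (^-mono-≤ k 0≤x x≤1)
  ^-antitone 0≤x x≤1 (s≤s j≤k) = *-monoʳ-≤ 0≤x (^-antitone 0≤x x≤1 j≤k)

  -- A Markov-type estimate: each selected element contributes at least `y`, and the others are not
  -- negative. For weights x^(degree) and y = x^s it bounds the number of vectors of degree at most
  -- `s`.
  length-filter-bound : ∀ {a p} {A : Set a} {P : Pred A p} (P? : Decidable P) {f y} →
    (∀ x → 0# ≤ f x) → (∀ {x} → P x → y ≤ f x) → ∀ xs →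
    fromℕ (length (List.filter P? xs)) * y ≤ listSum f xs
  length-filter-bound P? 0≤f y≤f []       = ≤-reflexive (zeroˡ _)
  length-filter-bound P? 0≤f y≤f (x ∷ xs) with P? x
  ... | yes Px = ≤-respˡ-≈ (sym (trans (distribʳ _ _ _) (+-congʳ (*-identityˡ _))))
    (+-mono-≤ (y≤f Px) (length-filter-bound P? 0≤f y≤f xs))
  ... | no  _  = ≤-respˡ-≈ (+-identityˡ _)
    (+-mono-≤ (0≤f x) (length-filter-bound P? 0≤f y≤f xs))

  -- With ρ the `d`-th root of `x`, x^s = ρ^(ds) = ρ^(n(q-1)), which cancels the `n`-th power of
  -- x^(-(q-1)/d). What is left is the `n`-th power of the geometric sum.
  objective^n : ∀ {n q s d} → d ℕ.* s ≡ n ℕ.* (q ℕ.∸ 1) → (2≤d : 2 ℕ.≤ d) →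
    ∀ x (0<x : 0# < x) (x<1 : x < 1#) →
    objective q d 2≤d x 0<x x<1 ^ n * x ^ s ≈ listSum (x ^_) (List.downFrom q) ^ n
  objective^n {n} {q} {s} {d@(suc _)} ds≡nq 2≤d x 0<x x<1 = begin
    objective q d 2≤d x 0<x x<1 ^ n * x ^ s
      ≈⟨ *-congˡ (trans (^-congˡ s (sym ρ^d≈x)) ρ^ds) ⟩
    objective q d 2≤d x 0<x x<1 ^ n * (ρ ^ (q ℕ.∸ 1)) ^ n
      ≈⟨ ^-distrib-* _ _ n ⟨
    (objective q d 2≤d x 0<x x<1 * ρ ^ (q ℕ.∸ 1)) ^ n
      ≈⟨ ^-congˡ n (x*inv*y≈x _ _) ⟩
    ((1# - x ^ q) * inv (1# - x) (1-x≉0 x<1)) ^ n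
      ≈⟨ ^-congˡ n (*-congʳ (listSum-geometric x q)) ⟨
    ((listSum (x ^_) (List.downFrom q) * (1# - x)) * inv (1# - x) (1-x≉0 x<1)) ^ n
      ≈⟨ ^-congˡ n (x*y*inv≈x _ (1-x≉0 x<1)) ⟩
    listSum (x ^_) (List.downFrom q) ^ n ∎
    where
    ρ : Carrier
    ρ = root d x (<⇒≤ 0<x)
    ρ^d≈x : ρ ^ d ≈ x
    ρ^d≈x = proj₂ (proj₂ (rootExists d (<⇒≤ 0<x)))
    ρ^ds : (ρ ^ d) ^ s ≈ (ρ ^ (q ℕ.∸ 1)) ^ n
    ρ^ds = begin
      (ρ ^ d) ^ s             ≈⟨ ^-assocʳ ρ d s ⟩
      ρ ^ (d ℕ.* s)           ≈⟨ ^-congʳ ρ (≡.trans ds≡nq (ℕ.*-comm n _)) ⟩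
      ρ ^ ((q ℕ.∸ 1) ℕ.* n)   ≈⟨ ^-assocʳ ρ (q ℕ.∸ 1) n ⟨
      (ρ ^ (q ℕ.∸ 1)) ^ n     ∎

  -- Roots and passage to the infimum.

  *-cancelʳ-≤ : ∀ {x y z} → 0# < z → x * z ≤ y * z → x ≤ y
  *-cancelʳ-≤ {x} {y} {z} 0<z xz≤yz =
    ≤-respˡ-≈ (x*y*inv≈x x z≉0) (≤-respʳ-≈ (x*y*inv≈x y z≉0)
      (*-monoˡ-≤ (<⇒≤ (inv-positive z≉0 0<z)) xz≤yz))
    where z≉0 = 0<⇒≉0 0<z

  ^-cancel-≤ : ∀ n .{{_ : ℕ.NonZero n}} {x y} → 0# ≤ y → x ^ n ≤ y ^ n → x ≤ y
  ^-cancel-≤ (suc n) {x} {y} 0≤y x^n≤y^n = ≮⇒≥ λ y<x →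
    let 0<x = ≤-<-trans 0≤y y<x
    -- If `y < x`, one factor `y` is kept and the others are raised to `x`; cancelling the positive
    -- power of `x` then gives `x ≤ y`.
    in <⇒≱ y<x (*-cancelʳ-≤ (^-positive n 0<x)
         (≤-trans x^n≤y^n (*-monoʳ-≤ 0≤y (^-mono-≤ n 0≤y (<⇒≤ y<x)))))

  fromℕ-nonNegative : ∀ k → 0# ≤ fromℕ k
  fromℕ-nonNegative zero    = ≤-refl
  fromℕ-nonNegative (suc k) = <⇒≤ (fromℕ-positive {suc k} (s≤s z≤n))

  fromℕ-mono-≤ : ∀ {j k} → j ℕ.≤ k → fromℕ j ≤ fromℕ k
  fromℕ-mono-≤ {k = k} z≤n = fromℕ-nonNegative k
  fromℕ-mono-≤ (s≤s j≤k)   = +-monoʳ-≤ 1# (fromℕ-mono-≤ j≤k)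

  -- Comparing with the n-th root of y turns a bound by powers into a lower bound
  -- of the values themselves.
  q*J-bound : ∀ {q d} (2≤q : 2 ℕ.≤ q) (2≤d : 2 ℕ.≤ d) n .{{_ : ℕ.NonZero n}} {y} → 0# ≤ y →
    (∀ x (0<x : 0# < x) (x<1 : x < 1#) → y ≤ objective q d 2≤d x 0<x x<1 ^ n) →
    y ≤ (fromℕ q * J q d 2≤q 2≤d) ^ n
  q*J-bound {q} {d} 2≤q 2≤d n {y} 0≤y y≤objective =
    ≤-respˡ-≈ r^n≈y (^-mono-≤ n 0≤r
      (≤-respʳ-≈ (sym q*J≈I) (proj₂ (proj₂ inf) r r≤values)))
    where
    -- The same term as in the definition of `J`, so that the factor `q` cancels and leaves this
    -- infimum.
    inf = infimum (ObjectiveValue q d 2≤d)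
      (objectiveValue-inhabited q d 2≤d) (0# , objectiveValue-nonNegative q d 2≤d)
    q≉0 = 0<⇒≉0 (fromℕ-positive (ℕ.<⇒≤ 2≤q))
    q*J≈I : fromℕ q * J q d 2≤q 2≤d ≈ proj₁ inf
    q*J≈I = trans (sym (*-assoc _ _ _)) (trans (*-congʳ (inv-inverseʳ q≉0)) (*-identityˡ _))
    r : Carrier
    r = root n y 0≤y
    0≤r : 0# ≤ r
    0≤r = proj₁ (proj₂ (rootExists n 0≤y))
    r^n≈y : r ^ n ≈ y
    r^n≈y = proj₂ (proj₂ (rootExists n 0≤y))
    r≤values : IsLowerBound (ObjectiveValue q d 2≤d) r
    r≤values v (x , 0<x , x<1 , v≈) = ^-cancel-≤ n
      (objectiveValue-nonNegative q d 2≤d v (x , 0<x , x<1 , v≈))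
      (≤-respˡ-≈ (sym r^n≈y) (≤-respʳ-≈ (sym (^-congˡ n v≈)) (y≤objective x 0<x x<1)))

-- The bound for subsets of a box.

corollary1p5 :
    ∀ {c ℓ₁ ℓ₂ a f} (ℝ : CompleteOrderedField c ℓ₁ ℓ₂) → let open Reals ℝ in
    (n q s : ℕ) → 1 ℕ.≤ n → (2≤q : 2 ℕ.≤ q) → 1 ℕ.≤ s →
    (A : Fin n → Pred Carrier a) → (∀ i → HasCardinality setoid (A i) q) →
    (F : Pred (Vector Carrier n) f) → F ⊆ box A →
    (∃[ k ] (HasCardinality setoid (distances F) k × k ℕ.≤ s)) →
    (d : ℕ) → d ℕ.* s ≡ n ℕ.* (q ℕ.∸ 1) → (2≤d : 2 ℕ.≤ d) →
    (m : ℕ) → HasCardinality (vectorSetoid n) F m →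
    fromℕ m ≤ fromℕ 2 * (fromℕ q * J q d 2≤q 2≤d) ^ n
corollary1p5 ℝ n@(suc _) q s _ 2≤q _ A |A|≡q F F⊆A (k , |d[F]|≡k , k≤s) d ds≡nq 2≤d m |F|≡m =
  -- The estimate is obtained with constant 1; its right side is non-negative, so doubling only
  -- enlarges it.
  ≤-trans m≤[qJ]^n (≤-respˡ-≈ (*-identityˡ _)
    (*-monoˡ-≤ (≤-trans (fromℕ-nonNegative m) m≤[qJ]^n)
      (≤-respˡ-≈ (+-identityʳ 1#) (fromℕ-mono-≤ {1} {2} (s≤s z≤n)))))
  where
  open Reals ℝ
  open PolynomialFunctions commutativeRing
  open RealSpaces ℝ
  elements : Fin n → Vector Carrier q
  elements i l = proj₁ (Bijection.to (|A|≡q i) l)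
  F⊆elements : ∀ {x} → F x → ∀ i → ∃[ l ] x i ≈ elements i l
  F⊆elements {x} x∈F i =
    let l , surjective = Bijection.surjective (|A|≡q i) (x i , F⊆A x∈F i)
    in l , sym (surjective ≡.refl)
  m≤[qJ]^n : fromℕ m ≤ (fromℕ q * J q d 2≤q 2≤d) ^ n
  m≤[qJ]^n = q*J-bound 2≤q 2≤d n (fromℕ-nonNegative m) λ x 0<x x<1 →
    -- Both sides are compared after multiplication by x^s: `m` is replaced by the number of reduced
    -- monomials, and that by their generating function.
    *-cancelʳ-≤ (^-positive s 0<x)
      (≤-trans
        (*-monoˡ-≤ (^-nonNegative s (<⇒≤ 0<x))
          (fromℕ-mono-≤ (fewDistances-bound elements F F⊆elements |d[F]|≡k k≤s |F|≡m)))
        (≤-trans (length-filter-bound (λ e → Vec.sum e ℕ.≤? s)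
            (λ e → ^-nonNegative (Vec.sum e) (<⇒≤ 0<x))
            (λ {e} → ^-antitone (<⇒≤ 0<x) (<⇒≤ x<1))
            (vectorsBelow q n))
          (≤-reflexive (trans (listSum-weight-vectorsBelow x q n)
            (sym (objective^n {n} {q} {s} ds≡nq 2≤d x 0<x x<1))))))
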